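{- Let $\mathcal{P}$ be a positive disjunctive Datalog program, and let $Rew(\mathcal{P}) = RV(\mathcal{P}) \cup ESV(\mathcal{P})$ be its rewritten version. Then for every atom $g(t)$ whose predicate symbol $g$ occurs in $\mathcal{P}$, the queries $\langle g(t), \mathcal{P}\rangle$ and $\langle g(t), Rew(\mathcal{P})\rangle$ are equivalent, $\langle g(t), \mathcal{P}\rangle \equiv \langle g(t), Rew(\mathcal{P})\rangle$; that is, for every database $D$ they have the same answer under the possible (brave) semantics and the same answer under the certain (cautious) semantics.
   Context: **Syntax.** Fix alphabets of constants, variables and predicate symbols. A term is a constant or a variable; atoms are $p(t_1,\dots,t_k)$ with $t_i$ terms (no function symbols). Predicate symbols are either base (extensional) or derived (intensional). A database $D$ is a finite set of ground facts over base predicates. A positive disjunctive Datalog program $\mathcal{P}$ is a finite set of rules $a_1\vee\cdots\vee a_m\leftarrow b_1,\dots,b_k$ with $m\ge 1$, $k\ge 0$, where the $a_i$ are atoms with derived predicate symbols and the $b_j$ are atoms (base or derived). $\mathcal{P}_D$ denotes $\mathcal{P}\cup D$. **Semantics.** $ground(\mathcal{P})$ is the set of instances of rules of $\mathcal{P}$ obtained by replacing variables with constants appearing in $\mathcal{P}$. An interpretation is a set of ground atoms over the predicates and constants of the program; it is a model if for every ground rule whose body is true, some head atom is true. For positive programs the stable models $\mathcal{SM}(\mathcal{P})$ are exactly the $\subseteq$-minimal models. A query is a pair $\langle G,\mathcal{P}\rangle$, $G$ an atom (the goal). For an interpretation $M$, $A(G,M)$ is the set of substitutions of constants for the variables of $G$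 making $G$ true in $M$. For a database $D$, the answer under possible (brave) semantics is $\bigcup_{M\in\mathcal{SM}(\mathcal{P}_D)}A(G,M)$; the answer under certain (cautious) semantics is $\bigcap_{M\in\mathcal{SM}(\mathcal{P}_D)}A(G,M)$. Two queries are equivalent ($\equiv$) if for every database their answers coincide under both semantics. **Rewriting.** $esv(\mathcal{P})$ is the program obtained by replacing each rule $a_1\vee\cdots\vee a_m\leftarrow B$ of $\mathcal{P}$ by the $m$ rules $a_i\leftarrow B$ ($1\le i\le m$) and the $m(m-1)$ rules $a_i\leftarrow a_j,B$ ($1\le i,j\le m$, $i\ne j$). $ESV(\mathcal{P})$ is obtained from $esv(\mathcal{P})$ by replacing every derived predicate symbol $p$ by a new (fresh, distinct) predicate symbol $P$ of the same arity; base predicates are unchanged. For a derived atom $a=p(s)$ write $A=P(s)$. Then $$RV(\mathcal{P})=\{a_1\vee\cdots\vee a_m\leftarrow A_1,\dots,A_m,B \;:\; a_1\vee\cdots\vee a_m\leftarrow B\in\mathcal{P}\},\qquad Rew(\mathcal{P})=RV(\mathcal{P})\cup ESV(\mathcal{P}).$$ -}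

module Defs where

open import Data.Fin using (Fin)
import Data.Fin.Properties as Fin
open import Data.List.Base
  using (List; []; _∷_; _++_; map; concatMap; filter; allFin; length; lookup)
open import Data.List.Membership.Propositional using (_∈_; _∉_)
open import Data.List.NonEmpty.Base as List⁺ using (List⁺; toList)
open import Data.List.Relation.Binary.Subset.Propositional using (_⊆_)
open import Data.List.Relation.Unary.All using (All)
open import Data.List.Relation.Unary.Any using (Any)
open import Data.Nat.Base using (ℕ)
open import Data.Product.Base using (∃; ∃-syntax; _×_; _,_)
open import Data.Vec.Base as Vec using (Vec)
open import Function.Base using (_∘_)
open import Relation.Binary.Definitions using (DecidableEquality)
open import Relation.Binary.PropositionalEquality using (_≡_)
open import Relation.Nullary.Decidable using (¬?)
open import Relation.Unary using (Pred; _≐_)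
open import Level using (0ℓ)

-- Predicate symbols are indexed by their arity.
record Signature : Set₁ where
  field
    Const Var    : Set
    Base Derived : ℕ → Set
    _≟ᶜ_ : DecidableEquality Const
    _≟ᵛ_ : DecidableEquality Var
    _≟ᵇ_ : ∀ {k} → DecidableEquality (Base k)
    _≟ᵈ_ : ∀ {k} → DecidableEquality (Derived k)

module Datalog (S : Signature) where
  open Signature S public

  data Term : Set where
    con : Const → Term
    var : Var → Term

  data Symbol (k : ℕ) : Set where
    base    : Base k → Symbol k
    derived : Derived k → Symbol k

  record Atom (Q : ℕ → Set) (T : Set) : Set where
    constructor atom
    field
      {arity} : ℕ
      pred    : Q arity
      args    : Vec T arity
  open Atom public

  -- h₁ ∨ ⋯ ∨ hₘ ← body, where m ≥ 1 and the head symbols are taken from Q.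
  infix 4 _←_
  record Rule (Q : ℕ → Set) (T : Set) : Set where
    constructor _←_
    field
      heads : List⁺ (Atom Q T)
      body  : List (Atom Symbol T)
  open Rule public

  mapPred : ∀ {Q Q′ T} → (∀ {k} → Q k → Q′ k) → Atom Q T → Atom Q′ T
  mapPred f (atom p ts) = atom (f p) ts

  mapArgs : ∀ {Q T T′} → (T → T′) → Atom Q T → Atom Q T′
  mapArgs f (atom p ts) = atom p (Vec.map f ts)

  mapRule : ∀ {Q T T′} → (T → T′) → Rule Q T → Rule Q T′
  mapRule f (hs ← bs) = List⁺.map (mapArgs f) hs ← map (mapArgs f) bs

  GroundAtom GroundRule : Set
  GroundAtom = Atom Symbol Const
  GroundRule = Rule Symbol Const

  Program : Set
  Program = List (Rule Derived Term)

  Database : Set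
  Database = List (Atom Base Const)

  -- Rules with arbitrary heads, so that facts over base predicates are rules too.
  Rules : Set
  Rules = List (Rule Symbol Term)

  rules : Program → Rules
  rules = map λ (hs ← bs) → List⁺.map (mapPred derived) hs ← bs

  fact : Atom Base Const → Rule Symbol Term
  fact a = List⁺.[ mapArgs con (mapPred base a) ] ← []

  infix 6 _⟨_⟩
  _⟨_⟩ : Program → Database → Rules
  P ⟨ D ⟩ = rules P ++ map fact D

  symbol : ∀ {Q T} → Atom Q T → ∃ Q
  symbol a = arity a , pred a

  ruleAtoms : ∀ {T} → Rule Symbol T → List (Atom Symbol T)
  ruleAtoms r = toList (heads r) ++ body r

  ruleTerms : ∀ {T} → Rule Symbol T → List T
  ruleTerms = concatMap (Vec.toList ∘ args) ∘ ruleAtoms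

  symbols : Rules → List (∃ Symbol)
  symbols = map symbol ∘ concatMap ruleAtoms

  terms : Rules → List Term
  terms = concatMap ruleTerms

  Subst : Set
  Subst = Var → Term

  apply : Subst → Term → Term
  apply σ (con c) = con c
  apply σ (var x) = σ x

  -- σ is only constrained on the variables of the rule, so that variable-free
  -- rules have an instance even when no constant is available.
  ground : Rules → Pred GroundRule 0ℓ
  ground R g = ∃[ r ] r ∈ R × ∃[ σ ]
    (∀ x → var x ∈ ruleTerms r → ∃[ c ] con c ∈ terms R × σ x ≡ con c) ×
    mapRule (apply σ) r ≡ mapRule con g

  -- The Herbrand base is finite, so interpretations are finite sets; these are
  -- represented by lists and compared by their elements.
  Interpretation : Rules → Pred (List GroundAtom) 0ℓ
  Interpretation R = All λ a →
    symbol a ∈ symbols R × (∀ c → c ∈ Vec.toList (args a) → con c ∈ terms R)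

  Model : Rules → Pred (List GroundAtom) 0ℓ
  Model R M = Interpretation R M ×
    (∀ g → ground R g → All (_∈ M) (body g) → Any (_∈ M) (toList (heads g)))

  -- All programs here are positive, so stable means ⊆-minimal.
  StableModel : Rules → Pred (List GroundAtom) 0ℓ
  StableModel R M = Model R M × (∀ N → Model R N → N ⊆ M → M ⊆ N)

  -- θ represents its restriction to the variables of G: membership depends on
  -- no other value of θ, and it forces θ to send these variables to constants.
  A : Atom Symbol Term → List GroundAtom → Pred Subst 0ℓ
  A G M θ = ∃[ a ] a ∈ M × mapArgs (apply θ) G ≡ mapArgs con a

  record Query : Set where
    constructor ⟪_,_⟫
    field
      goal    : Atom Symbol Term
      program : Program

  possible certain : Query → Database → Pred Subst 0ℓ
  possible ⟪ G , P ⟫ D θ = ∃[ M ] StableModel (P ⟨ D ⟩) M × A G M θ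
  certain  ⟪ G , P ⟫ D θ = ∀ M → StableModel (P ⟨ D ⟩) M → A G M θ

  infix 4 _≋_
  _≋_ : Query → Query → Set
  Q₁ ≋ Q₂ = ∀ D → (possible Q₁ D ≐ possible Q₂ D) × (certain Q₁ D ≐ certain Q₂ D)

  -- Heads are distinguished by position, as in the rules a_i ← a_j , B for i ≠ j.
  esvRule : Rule Derived Term → Program
  esvRule (hs ← bs) =
    map (λ i → List⁺.[ h i ] ← bs) (allFin m) ++
    concatMap (λ i → map (λ j → List⁺.[ h i ] ← mapPred derived (h j) ∷ bs)
                         (filter (λ j → ¬? (i Fin.≟ j)) (allFin m)))
              (allFin m)
    where
    m : ℕ
    m = length (toList hs)

    h : Fin m → Atom Derived Term
    h = lookup (toList hs)

  esv : Program → Program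
  esv = concatMap esvRule

  Renaming : Set
  Renaming = ∀ {k} → Derived k → Derived k

  renameSymbol : Renaming → ∀ {k} → Symbol k → Symbol k
  renameSymbol ρ (base p)    = base p
  renameSymbol ρ (derived p) = derived (ρ p)

  record Fresh (P : Program) (ρ : Renaming) : Set where
    field
      new      : ∀ {k} (p : Derived k) → (k , derived p) ∈ symbols (rules P) →
                 (k , derived (ρ p)) ∉ symbols (rules P)
      distinct : ∀ {k} (p q : Derived k) →
                 (k , derived p) ∈ symbols (rules P) →
                 (k , derived q) ∈ symbols (rules P) →
                 ρ p ≡ ρ q → p ≡ q

  ESV : Renaming → Program → Program
  ESV ρ P = map (λ (hs ← bs) → List⁺.map (mapPred ρ) hs ← map (mapPred (renameSymbol ρ)) bs)
                (esv P)

  RV : Renaming → Program → Program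
  RV ρ = map λ (hs ← bs) → hs ← map (mapPred (derived ∘ ρ)) (toList hs) ++ bs

  Rew : Renaming → Program → Program
  Rew ρ P = RV ρ P ++ ESV ρ P

{-# OPTIONS --safe #-}

-- Write F for the least model of ESV(P) ∪ D and call a ground atom a bounded if
-- its renaming lies in F.  If the body of a ground rule of P ∪ D is bounded, so
-- are all its heads; hence the bounded part of a model of P ∪ D is again a model,
-- and minimal models are bounded.  On bounded interpretations the extra body atoms
-- A₁ , … , Aₘ of RV(P) hold whenever the original body does, so M ↦ M ∪ F and
-- N ↦ {a ∈ N | a is bounded and in the vocabulary of P ∪ D} are inverse
-- correspondences between the minimal models of P ∪ D and of Rew(P) ∪ D.  They do
-- not change the atoms over the vocabulary of P, since by freshness F contributes
-- only facts of D there.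
module Submission where

open import Defs
open import Data.Empty using (⊥-elim)
open import Data.List.Base
  using (List; []; _∷_; _++_; map; concatMap; filter; allFin; length; lookup)
open import Data.List.Membership.Propositional using (_∈_; find; lose)
open import Data.List.Membership.Propositional.Properties
  using (∈-++⁺ˡ; ∈-++⁺ʳ; ∈-++⁻; ∈-map⁺; ∈-map⁻; ∈-filter⁺; ∈-filter⁻; ∈-∃++;
         ∈-concatMap⁺; ∈-concatMap⁻; ∈-lookup; ∈-allFin)
open import Data.List.NonEmpty.Base as List⁺ using (List⁺; toList) renaming (_∷_ to _∷⁺_)
open import Data.List.Properties as List
  using (length-++-sucʳ; map-++; map-∘; map-cong-local; ∷-injective)
open import Data.List.Relation.Binary.Subset.Propositional using (_⊆_)
open import Data.List.Relation.Unary.All as All using (All; []; _∷_)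
import Data.List.Relation.Unary.All.Properties as All
open import Data.List.Relation.Unary.Any as Any using (Any; here; there)
import Data.List.Relation.Unary.Any.Properties as Any
open import Data.Nat.Base using (ℕ; zero; suc)
import Data.Nat.Properties as ℕ
open import Data.Product.Base using (∃; ∃-syntax; _×_; _,_; proj₁; proj₂)
import Data.Product.Properties as Product
open import Data.Sum.Base using (_⊎_; inj₁; inj₂; [_,_]′)
open import Data.Vec.Base as Vec using (Vec; []; _∷_)
import Data.Vec.Properties as Vec
open import Function.Base using (_∘_; id)
open import Function.Definitions using (Injective)
open import Level using (0ℓ)
open import Relation.Binary.Definitions using (DecidableEquality)
open import Relation.Binary.PropositionalEquality
  using (_≡_; refl; sym; trans; cong; cong₂; subst)
open import Relation.Nullary.Decidable using (Dec; yes; no; map′; _×-dec_)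
open import Relation.Nullary.Negation using (contradiction)
open import Relation.Unary using (Pred; _≐_)

-- Images of maps on lists and vectors.

private variable
  X Y : Set

-- Groundness of a term, atom or rule is membership in the image of the embedding `con`, so deciding
-- it also yields the ground object.
Image : (X → Y) → Y → Set
Image f y = ∃[ x ] f x ≡ y

imageList? : {f : X → Y} → (∀ y → Dec (Image f y)) → ∀ ys → Dec (Image (map f) ys)
imageList? f? []       = yes ([] , refl)
imageList? f? (y ∷ ys) = map′
  (λ ((x , p) , (xs , q)) → x ∷ xs , cong₂ _∷_ p q)
  (λ { (x ∷ xs , refl) → (x , refl) , (xs , refl) })
  (f? y ×-dec imageList? f? ys)

imageList⁺? : {f : X → Y} → (∀ y → Dec (Image f y)) → ∀ ys → Dec (Image (List⁺.map f) ys)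
imageList⁺? f? (y ∷⁺ ys) = map′
  (λ ((x , p) , (xs , q)) → x ∷⁺ xs , cong₂ _∷⁺_ p q)
  (λ { (x ∷⁺ xs , refl) → (x , refl) , (xs , refl) })
  (f? y ×-dec imageList? f? ys)

imageVec? : {f : X → Y} → (∀ y → Dec (Image f y)) →
            ∀ {k} (ys : Vec Y k) → Dec (Image (Vec.map f) ys)
imageVec? f? []       = yes ([] , refl)
imageVec? f? (y ∷ ys) = map′
  (λ ((x , p) , (xs , q)) → x ∷ xs , cong₂ _∷_ p q)
  (λ { (x ∷ xs , refl) → (x , refl) , (xs , refl) })
  (f? y ×-dec imageVec? f? ys)

vecMap-injective : {f : X → Y} → Injective _≡_ _≡_ f →
                   ∀ {k} → Injective _≡_ _≡_ (Vec.map {n = k} f)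
vecMap-injective inj {x = []}    {[]}    _ = refl
vecMap-injective inj {x = _ ∷ _} {_ ∷ _} p with q , r ← Vec.∷-injective p =
  cong₂ _∷_ (inj q) (vecMap-injective inj r)

-- Used to strip the guards from the ground body of an `RV` rule: only the suffix is kept.
map≡++⁻ : (f : X → Y) → ∀ zs xs {ys} → map f zs ≡ xs ++ ys →
          ∃[ zs′ ] zs′ ⊆ zs × map f zs′ ≡ ys
map≡++⁻ f zs       []       p = zs , id , p
map≡++⁻ f (z ∷ zs) (x ∷ xs) p
  with zs′ , sub , q ← map≡++⁻ f zs xs (proj₂ (∷-injective p)) = zs′ , there ∘ sub , q

-- Traces an atom or term of a ground instance back to the rule: `f` is then a substitution and `g`
-- the embedding of constants.
preimage : ∀ {Z : Set} {f : X → Z} {g : Y → Z} {xs ys} → map f xs ≡ map g ys →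
           ∀ {y} → y ∈ ys → ∃[ x ] x ∈ xs × g y ≡ f x
preimage {f = f} {g} e y∈ = ∈-map⁻ f (subst (_ ∈_) (sym e) (∈-map⁺ g y∈))

∈-concatMap : (f : X → List Y) → ∀ {x y xs} → x ∈ xs → y ∈ f x → y ∈ concatMap f xs
∈-concatMap f x∈xs y∈fx = ∈-concatMap⁺ f (lose x∈xs y∈fx)

∈-concatMap-inv : (f : X → List Y) → ∀ xs {y} → y ∈ concatMap f xs →
                  ∃[ x ] x ∈ xs × y ∈ f x
∈-concatMap-inv f xs y∈ = find (∈-concatMap⁻ f {xs} y∈)

module _ (S : Signature) where
  open Datalog S

  private variable
    Q : ℕ → Set
    T T′ : Set

  -- Decidable equality and groundness.

  _≟ˢ_ : ∀ {k} → DecidableEquality (Symbol k)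
  base p    ≟ˢ base q    = map′ (cong base) (λ { refl → refl }) (p ≟ᵇ q)
  base p    ≟ˢ derived q = no λ ()
  derived p ≟ˢ base q    = no λ ()
  derived p ≟ˢ derived q = map′ (cong derived) (λ { refl → refl }) (p ≟ᵈ q)

  _≟∃ˢ_ : DecidableEquality (∃ Symbol)
  _≟∃ˢ_ = Product.≡-dec ℕ._≟_ _≟ˢ_

  args-injective : ∀ {k} {p : Q k} {ts us : Vec T k} →
                   _≡_ {A = Atom Q T} (atom p ts) (atom p us) → ts ≡ us
  args-injective refl = refl

  _≟ᵃ_ : DecidableEquality GroundAtom
  atom {k} p ts ≟ᵃ atom {l} q us with (k , p) ≟∃ˢ (l , q)
  ... | no  p≢q  = no (p≢q ∘ cong symbol)
  ... | yes refl = map′ (cong (atom p)) args-injective (Vec.≡-dec _≟ᶜ_ ts us)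

  open import Data.List.Membership.DecPropositional _≟ᵃ_ using (_∈?_)
  open import Data.List.Membership.DecPropositional _≟∃ˢ_ using () renaming (_∈?_ to _∈ˢ?_)

  mapArgs-injective : {f : T → T′} → Injective _≡_ _≡_ f →
                      Injective _≡_ _≡_ (mapArgs {Q = Q} f)
  mapArgs-injective inj {atom {k} p ts} {atom {l} q us} e = go (cong symbol e) e
    where
    -- The symbols are identified first; only then do the argument vectors have the same type.
    go : (k , p) ≡ (l , q) → atom p (Vec.map _ ts) ≡ atom q (Vec.map _ us) →
         atom p ts ≡ atom q us
    go refl e = cong (atom p) (vecMap-injective inj (args-injective e))

  con-injective : Injective _≡_ _≡_ con
  con-injective refl = refl

  mapCon-injective : Injective _≡_ _≡_ (map (mapArgs {Q = Q} con))
  mapCon-injective = List.map-injective (mapArgs-injective con-injective)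

  mapRule-con-injective : Injective _≡_ _≡_ (mapRule {Q = Q} con)
  mapRule-con-injective e
    with refl ← mapCon-injective (cong (toList ∘ heads) e)
       | refl ← mapCon-injective (cong body e) = refl

  groundTerm? : ∀ t → Dec (Image con t)
  groundTerm? (con c) = yes (c , refl)
  groundTerm? (var x) = no λ ()

  groundAtom? : (a : Atom Q Term) → Dec (Image (mapArgs con) a)
  groundAtom? (atom p ts) = map′
    (λ (us , e) → atom p us , cong (atom p) e)
    (λ { (atom _ us , refl) → us , refl })
    (imageVec? groundTerm? ts)

  groundRule? : (r : Rule Q Term) → Dec (Image (mapRule con) r)
  groundRule? (hs ← bs) = map′
    (λ ((hs′ , p) , (bs′ , q)) → (hs′ ← bs′) , cong₂ _←_ p q)
    (λ { ((hs′ ← bs′) , refl) → (hs′ , refl) , (bs′ , refl) })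
    (imageList⁺? groundAtom? hs ×-dec imageList? groundAtom? bs)

  -- Finite enumeration of the ground instances of a rule.

  Grounds : List Term → Subst → List Term → Set
  Grounds C σ ts = ∀ x → var x ∈ ts → ∃[ c ] con c ∈ C × σ x ≡ con c

  -- `ground R g` unfolds to some `r ∈ R` with `Instance (terms R) r g`. Keeping the term list
  -- separate lets instances pass between programs.
  Instance : List Term → Rule Symbol Term → Pred GroundRule 0ℓ
  Instance C r g =
    ∃[ σ ] Grounds C σ (ruleTerms r) × mapRule (apply σ) r ≡ mapRule con g

  _[_↦_] : Subst → Var → Term → Subst
  (σ [ x ↦ t ]) y with y ≟ᵛ x
  ... | yes _ = t
  ... | no  _ = σ y

  substs : List Term → List Term → List Subst
  -- Values outside the listed variables are arbitrary; `var` is the default.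
  substs C []           = var ∷ []
  substs C (con _ ∷ ts) = substs C ts
  substs C (var x ∷ ts) =
    concatMap (λ t → map (_[ x ↦ t ]) (substs C ts)) (filter groundTerm? C)

  substs-sound : ∀ {C} ts {σ} → σ ∈ substs C ts → Grounds C σ ts
  substs-sound (con _ ∷ ts) σ∈ x (there x∈) = substs-sound ts σ∈ x x∈
  substs-sound {C} (var x ∷ ts) σ∈ y y∈
    with t , t∈ , σ∈′ ← ∈-concatMap-inv
           (λ t → map (_[ x ↦ t ]) (substs C ts)) (filter groundTerm? C) σ∈
    with τ , τ∈ , refl ← ∈-map⁻ (_[ x ↦ t ]) σ∈′
    with t∈C , c , refl ← ∈-filter⁻ groundTerm? {xs = C} t∈
    with y ≟ᵛ x
  ... | yes _  = c , t∈C , refl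
  ... | no y≢x with y∈
  ...   | here refl = contradiction refl y≢x
  ...   | there y∈′ = substs-sound ts τ∈ y y∈′

  -- `σ` itself may be missing from the list, having other values off `ts`; agreement on `ts`
  -- suffices by `mapRule-cong`.
  substs-complete : ∀ {C} ts {σ} → Grounds C σ ts →
                    ∃[ τ ] τ ∈ substs C ts × (∀ x → var x ∈ ts → τ x ≡ σ x)
  substs-complete [] _ = var , here refl , λ _ ()
  substs-complete (con _ ∷ ts) gr
    with τ , τ∈ , eq ← substs-complete ts (λ x x∈ → gr x (there x∈)) =
    τ , τ∈ , λ { x (there x∈) → eq x x∈ }
  substs-complete {C} (var x ∷ ts) {σ} gr
    with τ , τ∈ , eq ← substs-complete ts (λ x x∈ → gr x (there x∈))
       | c , c∈ , p ← gr x (here refl) =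
    τ [ x ↦ con c ] ,
    ∈-concatMap _ (∈-filter⁺ groundTerm? c∈ (c , refl)) (∈-map⁺ _ τ∈) , agree
    where
    agree : ∀ y → var y ∈ var x ∷ ts → (τ [ x ↦ con c ]) y ≡ σ y
    agree y y∈ with y ≟ᵛ x
    ... | yes refl = sym p
    ... | no y≢x with y∈
    ...   | here refl = contradiction refl y≢x
    ...   | there y∈′ = eq y y∈′

  ∈-ruleTerms : ∀ {r : Rule Symbol T} {a t} → a ∈ ruleAtoms r → t ∈ Vec.toList (args a) →
                t ∈ ruleTerms r
  ∈-ruleTerms = ∈-concatMap _

  apply-cong : ∀ {σ τ : Subst} {k} (ts : Vec Term k) →
               (∀ x → var x ∈ Vec.toList ts → τ x ≡ σ x) →
               Vec.map (apply τ) ts ≡ Vec.map (apply σ) ts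
  apply-cong []           eq = refl
  apply-cong (con c ∷ ts) eq = cong (con c ∷_) (apply-cong ts λ x → eq x ∘ there)
  apply-cong (var x ∷ ts) eq =
    cong₂ _∷_ (eq x (here refl)) (apply-cong ts λ x → eq x ∘ there)

  mapRule-cong : ∀ {σ τ : Subst} (r : Rule Symbol Term) →
                 (∀ x → var x ∈ ruleTerms r → τ x ≡ σ x) →
                 mapRule (apply τ) r ≡ mapRule (apply σ) r
  mapRule-cong {σ} {τ} r@(h ∷⁺ hs ← bs) eq =
    cong₂ _←_ (cong₂ _∷⁺_ (on h (here refl))
                 (map-cong-local (All.tabulate λ a∈ → on _ (there (∈-++⁺ˡ a∈)))))
              (map-cong-local (All.tabulate λ a∈ → on _ (∈-++⁺ʳ (h ∷ hs) a∈)))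
    where
    on : ∀ a → a ∈ ruleAtoms r → mapArgs (apply τ) a ≡ mapArgs (apply σ) a
    on a a∈ = cong (atom (pred a))
      (apply-cong (args a) λ x x∈ → eq x (∈-ruleTerms {r = r} a∈ x∈))

  grounding : Rule Symbol Term → List GroundRule
  grounding r with groundRule? r
  ... | yes (g , _) = g ∷ []
  ... | no  _       = []

  grounding⁺ : ∀ {r} g → r ≡ mapRule con g → g ∈ grounding r
  grounding⁺ {r} g e with groundRule? r
  ... | yes (g′ , e′) = here (mapRule-con-injective (sym (trans e′ e)))
  ... | no  ¬g        = contradiction (g , sym e) ¬g

  grounding⁻ : ∀ {r g} → g ∈ grounding r → r ≡ mapRule con g
  grounding⁻ {r} g∈ with groundRule? r
  grounding⁻ (here refl) | yes (_ , e) = sym e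

  instances : List Term → Rule Symbol Term → List GroundRule
  instances C r = concatMap (λ σ → grounding (mapRule (apply σ) r)) (substs C (ruleTerms r))

  instances⁺ : ∀ {C r g} → Instance C r g → g ∈ instances C r
  instances⁺ {r = r} {g} (σ , gr , e) with τ , τ∈ , eq ← substs-complete (ruleTerms r) gr =
    ∈-concatMap _ τ∈ (grounding⁺ g (trans (mapRule-cong r eq) e))

  instances⁻ : ∀ {C r g} → g ∈ instances C r → Instance C r g
  instances⁻ {r = r} g∈ with σ , σ∈ , g∈′ ← ∈-concatMap-inv _ (substs _ (ruleTerms r)) g∈ =
    σ , substs-sound (ruleTerms r) σ∈ , grounding⁻ g∈′

  -- Least sets closed under finitely many ground rules.

  -- All heads are demanded, not just one; on single-head rules, such as those of `esv`, this is the
  -- usual Horn closure.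
  Closed : List GroundRule → Pred (Pred GroundAtom 0ℓ) 0ℓ
  Closed L Z = ∀ {g} → g ∈ L → All Z (body g) → All Z (toList (heads g))

  -- Rules are discarded once fired, so the number of remaining rules decreases.
  saturate : ∀ n L → length L ≡ n → ∀ F → ∃[ F′ ]
    F ⊆ F′ × Closed L (_∈ F′) × (∀ Z → Closed L Z → All Z F → All Z F′)
  saturate n L len F with Any.any? (λ g → All.all? (_∈? F) (body g)) L
  ... | no none = F , id , (λ g∈ b⊆ → contradiction (lose g∈ b⊆) none) , λ _ _ ZF → ZF
  ... | yes some with g , g∈ , fires ← find some with xs , ys , refl ← ∈-∃++ g∈ with n
  ...   | zero  = contradiction (trans (sym (length-++-sucʳ xs g ys)) len) λ ()
  ...   | suc m
    with F′ , sub , closed , least ← saturate m (xs ++ ys)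
           (ℕ.suc-injective (trans (sym (length-++-sucʳ xs g ys)) len)) (toList (heads g) ++ F) =
    F′ , sub ∘ ∈-++⁺ʳ _ , closed′ , λ Z ZL ZF →
      least Z (ZL ∘ weaken) (All.++⁺ (ZL g∈ (All.map (All.lookup ZF) fires)) ZF)
    where
    weaken : xs ++ ys ⊆ xs ++ g ∷ ys
    weaken = [ ∈-++⁺ˡ , ∈-++⁺ʳ xs ∘ there ]′ ∘ ∈-++⁻ xs

    closed′ : Closed (xs ++ g ∷ ys) (_∈ F′)
    closed′ g′∈ b⊆ with ∈-++⁻ xs g′∈
    ... | inj₁ g′∈xs         = closed (∈-++⁺ˡ g′∈xs) b⊆
    -- The fired rule has left the list, but its heads were added to the set before recursing.
    ... | inj₂ (here refl)   = All.tabulate (sub ∘ ∈-++⁺ˡ)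
    ... | inj₂ (there g′∈ys) = closed (∈-++⁺ʳ xs g′∈ys) b⊆

  leastClosed : ∀ L → ∃[ F ] Closed L (_∈ F) × (∀ Z → Closed L Z → All Z F)
  leastClosed L with F , _ , closed , least ← saturate (length L) L refl [] =
    F , closed , λ Z ZL → least Z ZL []

  -- Symbols and terms occurring in rules.

  lift : Rule Derived T → Rule Symbol T
  lift (hs ← bs) = List⁺.map (mapPred derived) hs ← bs

  body⊆ : (r : Rule Derived T) → body r ⊆ ruleAtoms (lift r)
  body⊆ r = ∈-++⁺ʳ (map (mapPred derived) (toList (heads r)))

  head∈ : (r : Rule Derived T) → ∀ {h} → h ∈ toList (heads r) →
          mapPred derived h ∈ ruleAtoms (lift r)
  head∈ r h∈ = ∈-++⁺ˡ (∈-map⁺ (mapPred derived) h∈)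

  ∈-symbols : ∀ {R r a} → r ∈ R → a ∈ ruleAtoms r → symbol a ∈ symbols R
  ∈-symbols r∈ a∈ = ∈-map⁺ symbol (∈-concatMap ruleAtoms r∈ a∈)

  symbols⁻ : ∀ R {s} → s ∈ symbols R → ∃[ r ] r ∈ R × ∃[ a ] a ∈ ruleAtoms r × s ≡ symbol a
  symbols⁻ R s∈ with a , a∈ , e ← ∈-map⁻ symbol s∈
                with r , r∈ , a∈′ ← ∈-concatMap-inv ruleAtoms R a∈ = r , r∈ , a , a∈′ , e

  terms-mono : ∀ {R R′} → (∀ {r} → r ∈ R → ∃[ r′ ] r′ ∈ R′ × ruleTerms r ⊆ ruleTerms r′) →
               terms R ⊆ terms R′
  terms-mono {R} cover t∈ with r , r∈ , t∈r ← ∈-concatMap-inv ruleTerms R t∈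
                          with r′ , r′∈ , sub ← cover r∈ = ∈-concatMap ruleTerms r′∈ (sub t∈r)

  -- Argument lists are compared instead of atoms because renaming changes the predicate symbols
  -- only.
  ruleTerms-mono : (r r′ : Rule Symbol T) →
    (∀ {a} → a ∈ ruleAtoms r →
       ∃[ b ] b ∈ ruleAtoms r′ × Vec.toList (args b) ≡ Vec.toList (args a)) →
    ruleTerms r ⊆ ruleTerms r′
  ruleTerms-mono r r′ cover t∈
    with a , a∈ , t∈a ← ∈-concatMap-inv (Vec.toList ∘ args) (ruleAtoms r) t∈
    with b , b∈ , e ← cover a∈ = ∈-ruleTerms {r = r′} b∈ (subst (_ ∈_) (sym e) t∈a)

  ruleAtoms-mapRule : (f : T → T′) (r : Rule Symbol T) →
                      ruleAtoms (mapRule f r) ≡ map (mapArgs f) (ruleAtoms r)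
  ruleAtoms-mapRule f r = sym (map-++ (mapArgs f) (toList (heads r)) (body r))

  Herbrand : Rules → Pred GroundAtom 0ℓ
  Herbrand R a = symbol a ∈ symbols R × (∀ c → c ∈ Vec.toList (args a) → con c ∈ terms R)

  Instance-weaken : ∀ {C C′ r g} → C ⊆ C′ → Instance C r g → Instance C′ r g
  Instance-weaken C⊆ (σ , gr , e) =
    σ , (λ x x∈ → let c , c∈ , p = gr x x∈ in c , C⊆ c∈ , p) , e

  -- Each atom of an instance comes from an atom of `r` with the same symbol; its constants are
  -- either written in `r` or values of `σ`, hence terms of `R`.
  ground-herbrand : ∀ {R r g a} → r ∈ R → Instance (terms R) r g → a ∈ ruleAtoms g →
                    Herbrand R a
  ground-herbrand {R} {r} {g} {a} r∈ (σ , gr , e) a∈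
    with b , b∈ , eb ← preimage (trans (sym (ruleAtoms-mapRule (apply σ) r))
           (trans (cong ruleAtoms e) (ruleAtoms-mapRule con g))) a∈ =
    subst (_∈ symbols R) (sym (cong symbol eb)) (∈-symbols r∈ b∈) , known
    where
    constant : ∀ t {c} → t ∈ ruleTerms r → con c ≡ apply σ t → con c ∈ terms R
    constant (con _) t∈ refl = ∈-concatMap ruleTerms r∈ t∈
    constant (var x) t∈ p with c′ , c′∈ , q ← gr x t∈ =
      subst (_∈ terms R) (sym (trans p q)) c′∈

    known : ∀ c → c ∈ Vec.toList (args a) → con c ∈ terms R
    known c c∈ with t , t∈ , p ← preimage (trans (sym (Vec.toList-map (apply σ) (args b)))
          (trans (cong (Vec.toList ∘ args) (sym eb)) (Vec.toList-map con (args a)))) c∈ =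
      constant t (∈-ruleTerms {r = r} b∈ t∈) p

  -- Ground instances of database facts.

  baseAtom : Atom Base Const → GroundAtom
  baseAtom = mapPred base

  factRule : Atom Base Const → GroundRule
  factRule d = List⁺.[ baseAtom d ] ← []

  fact⁻ : ∀ {C d g} → Instance C (fact d) g → g ≡ factRule d
  fact⁻ {d = d} (σ , _ , e) = mapRule-con-injective (trans (sym e)
    (cong (λ ts → List⁺.[ atom (base (pred d)) ts ] ← []) (sym (Vec.map-∘ (apply σ) con (args d)))))

  fact⁺ : ∀ {C d} → Instance C (fact d) (factRule d)
  fact⁺ {C} {d} = var , noVars (args d) ,
    cong (λ ts → List⁺.[ atom (base (pred d)) ts ] ← []) (sym (Vec.map-∘ (apply var) con (args d)))
    where
    noVars : ∀ {k} (cs : Vec Const k) → Grounds C var (Vec.toList (Vec.map con cs) ++ [])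
    noVars (_ ∷ cs) x (there x∈) = noVars cs x x∈

  -- A model makes some head true, whereas closure asks for all; with a single head the two agree.
  singleHead : ∀ {Z : Pred GroundAtom 0ℓ} {h} hs → List⁺.[ h ] ≡ List⁺.map (mapArgs con) hs →
               Any Z (toList hs) → All Z (toList hs)
  singleHead (_ ∷⁺ []) _ (here z) = z ∷ []

  -- The rules of the original and the rewritten program.

  module _ (P : Program) (ρ : Renaming) (fresh : Fresh P ρ) (D : Database) where
    open Fresh fresh using (new)

    R R′ H : Rules
    R  = P ⟨ D ⟩
    R′ = Rew ρ P ⟨ D ⟩
    H  = rules (ESV ρ P) ++ map fact D

    C : List Term
    C = terms R′

    ρ̂ : Atom Symbol T → Atom Symbol T
    ρ̂ = mapPred (renameSymbol ρ)

    rename guard : Rule Derived Term → Rule Derived Term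
    rename (hs ← bs) = List⁺.map (mapPred ρ) hs ← map ρ̂ bs
    guard  (hs ← bs) = hs ← map (mapPred (derived ∘ ρ)) (toList hs) ++ bs

    -- `split` covers both `a_i ← B` and `a_i ← a_j , B`: it records that head and body stem from
    -- one rule `p` of `P`.
    data Source : Rule Symbol Term → Set where
      split : ∀ {p h bs} → p ∈ P → h ∈ toList (heads p) → bs ⊆ ruleAtoms (lift p) →
              Source (lift (rename (List⁺.[ h ] ← bs)))
      given : ∀ {d} → d ∈ D → Source (fact d)

    esvRule⁻ : ∀ p {q} → q ∈ esvRule p → ∃[ h ] ∃[ bs ]
               h ∈ toList (heads p) × bs ⊆ ruleAtoms (lift p) × q ≡ (List⁺.[ h ] ← bs)
    esvRule⁻ (hs ← bs) q∈
      with ∈-++⁻ (map (λ i → List⁺.[ lookup (toList hs) i ] ← bs) (allFin (length (toList hs)))) q∈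
    ... | inj₁ q∈₁
      with i , _ , refl ← ∈-map⁻ (λ i → List⁺.[ lookup (toList hs) i ] ← bs)
                            {xs = allFin (length (toList hs))} q∈₁ =
      _ , _ , ∈-lookup i , body⊆ (hs ← bs) , refl
    ... | inj₂ q∈₂
      with i , _ , q∈ᵢ ← ∈-concatMap-inv _ (allFin _) q∈₂
      with j , _ , refl ← ∈-map⁻
             (λ j → List⁺.[ lookup (toList hs) i ] ←
                    mapPred derived (lookup (toList hs) j) ∷ bs) q∈ᵢ =
      _ , _ , ∈-lookup i ,
      (λ { (here refl) → head∈ (hs ← bs) (∈-lookup j)
         ; (there b∈)  → body⊆ (hs ← bs) b∈ }) , refl

    esvRule⁺ : ∀ p {h} → h ∈ toList (heads p) → (List⁺.[ h ] ← body p) ∈ esvRule p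
    esvRule⁺ p h∈ = subst (λ h → (List⁺.[ h ] ← body p) ∈ esvRule p) (sym (Any.lookup-index h∈))
      (∈-++⁺ˡ (∈-map⁺ _ (∈-allFin (Any.index h∈))))

    H⁻ : ∀ {r} → r ∈ H → Source r
    H⁻ r∈ with ∈-++⁻ (rules (ESV ρ P)) r∈
    ... | inj₂ r∈D with d , d∈ , refl ← ∈-map⁻ fact r∈D = given d∈
    ... | inj₁ r∈E
      with q , q∈ , refl ← ∈-map⁻ lift r∈E
      with q′ , q′∈ , refl ← ∈-map⁻ rename q∈
      with p , p∈ , q′∈p ← ∈-concatMap-inv esvRule P q′∈
      with h , bs , h∈ , bs⊆ , refl ← esvRule⁻ p q′∈p = split p∈ h∈ bs⊆

    split∈H : ∀ {p h} → p ∈ P → h ∈ toList (heads p) →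
              lift (rename (List⁺.[ h ] ← body p)) ∈ H
    split∈H {p} p∈ h∈ = ∈-++⁺ˡ (∈-map⁺ lift (∈-map⁺ rename (∈-concatMap esvRule p∈ (esvRule⁺ p h∈))))

    fact∈H : ∀ {d} → d ∈ D → fact d ∈ H
    fact∈H d∈ = ∈-++⁺ʳ (rules (ESV ρ P)) (∈-map⁺ fact d∈)

    R⁻ : ∀ {r} → r ∈ R → (∃[ p ] p ∈ P × r ≡ lift p) ⊎ (∃[ d ] d ∈ D × r ≡ fact d)
    R⁻ r∈ with ∈-++⁻ (rules P) r∈
    ... | inj₁ r∈P = inj₁ (∈-map⁻ lift r∈P)
    ... | inj₂ r∈D = inj₂ (∈-map⁻ fact r∈D)

    lift∈R : ∀ {p} → p ∈ P → lift p ∈ R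
    lift∈R p∈ = ∈-++⁺ˡ (∈-map⁺ lift p∈)

    fact∈R : ∀ {d} → d ∈ D → fact d ∈ R
    fact∈R d∈ = ∈-++⁺ʳ (rules P) (∈-map⁺ fact d∈)

    guard∈R′ : ∀ {p} → p ∈ P → lift (guard p) ∈ R′
    guard∈R′ p∈ = ∈-++⁺ˡ (∈-map⁺ lift (∈-++⁺ˡ (∈-map⁺ guard p∈)))

    H⊆R′ : H ⊆ R′
    H⊆R′ r∈ with ∈-++⁻ (rules (ESV ρ P)) r∈
    ... | inj₂ r∈D = ∈-++⁺ʳ (rules (Rew ρ P)) r∈D
    ... | inj₁ r∈E with q , q∈ , refl ← ∈-map⁻ lift r∈E =
      ∈-++⁺ˡ (∈-map⁺ lift (∈-++⁺ʳ (RV ρ P) q∈))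

    R′⁻ : ∀ {r} → r ∈ R′ → (∃[ p ] p ∈ P × r ≡ lift (guard p)) ⊎ r ∈ H
    R′⁻ r∈ with ∈-++⁻ (rules (Rew ρ P)) r∈
    ... | inj₂ r∈D = inj₂ (∈-++⁺ʳ (rules (ESV ρ P)) r∈D)
    ... | inj₁ r∈Rew with q , q∈ , refl ← ∈-map⁻ lift r∈Rew with ∈-++⁻ (RV ρ P) q∈
    ...   | inj₁ q∈RV with p , p∈ , refl ← ∈-map⁻ guard q∈RV = inj₁ (p , p∈ , refl)
    ...   | inj₂ q∈ESV = inj₂ (∈-++⁺ˡ (∈-map⁺ lift q∈ESV))

    -- Equality of the two Herbrand universes.

    split-atoms : ∀ {p h bs a} → h ∈ toList (heads p) → bs ⊆ ruleAtoms (lift p) →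
                  a ∈ ruleAtoms (lift (rename (List⁺.[ h ] ← bs))) →
                  ∃[ b ] b ∈ ruleAtoms (lift p) × a ≡ ρ̂ b
    split-atoms {p} h∈ bs⊆ (here refl) = _ , head∈ p h∈ , refl
    split-atoms h∈ bs⊆ (there a∈) with b , b∈ , refl ← ∈-map⁻ ρ̂ a∈ = b , bs⊆ b∈ , refl

    guard-atoms : ∀ p {a} → a ∈ ruleAtoms (lift (guard p)) →
                  ∃[ b ] b ∈ ruleAtoms (lift p) × Vec.toList (args b) ≡ Vec.toList (args a)
    guard-atoms (hs ← bs) a∈ with ∈-++⁻ (map (mapPred derived) (toList hs)) a∈
    ... | inj₁ a∈hs = _ , ∈-++⁺ˡ a∈hs , refl
    ... | inj₂ a∈′ with ∈-++⁻ (map (mapPred (derived ∘ ρ)) (toList hs)) a∈′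
    ...   | inj₂ a∈bs = _ , body⊆ (hs ← bs) a∈bs , refl
    ...   | inj₁ a∈A with h , h∈ , refl ← ∈-map⁻ _ a∈A =
      _ , head∈ (hs ← bs) h∈ , refl

    guard-terms : ∀ p → ruleTerms (lift (guard p)) ⊆ ruleTerms (lift p)
    guard-terms p = ruleTerms-mono (lift (guard p)) (lift p) (guard-atoms p)

    lift⊆guard : ∀ p → ruleAtoms (lift p) ⊆ ruleAtoms (lift (guard p))
    lift⊆guard p@(hs ← bs) =
      [ ∈-++⁺ˡ , body⊆ (guard p) ∘ ∈-++⁺ʳ (map (mapPred (derived ∘ ρ)) (toList hs)) ]′ ∘
      ∈-++⁻ (map (mapPred derived) (toList hs))

    terms-guard : ∀ p → ruleTerms (lift p) ⊆ ruleTerms (lift (guard p))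
    terms-guard p = ruleTerms-mono (lift p) (lift (guard p)) λ a∈ → _ , lift⊆guard p a∈ , refl

    split-terms : ∀ {p h bs} → h ∈ toList (heads p) → bs ⊆ ruleAtoms (lift p) →
                  ruleTerms (lift (rename (List⁺.[ h ] ← bs))) ⊆ ruleTerms (lift p)
    split-terms {p} {h} {bs} h∈ bs⊆ = ruleTerms-mono (lift (rename (List⁺.[ h ] ← bs))) (lift p)
      λ a∈ → let b , b∈ , e = split-atoms {p} h∈ bs⊆ a∈
             in b , b∈ , cong (Vec.toList ∘ args) (sym e)

    terms-R⊆R′ : terms R ⊆ terms R′
    terms-R⊆R′ = terms-mono λ r∈ → cover (R⁻ r∈)
      where
      cover : ∀ {r} → (∃[ p ] p ∈ P × r ≡ lift p) ⊎ (∃[ d ] d ∈ D × r ≡ fact d) →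
              ∃[ r′ ] r′ ∈ R′ × ruleTerms r ⊆ ruleTerms r′
      cover (inj₁ (p , p∈ , refl)) = _ , guard∈R′ p∈ , terms-guard p
      cover (inj₂ (d , d∈ , refl)) = _ , H⊆R′ (fact∈H d∈) , id

    -- Guards and renamed atoms reuse the argument tuples of the original rule, so no new term
    -- arises.
    terms-R′⊆R : terms R′ ⊆ terms R
    terms-R′⊆R = terms-mono λ r∈ → cover (R′⁻ r∈)
      where
      cover : ∀ {r} → (∃[ p ] p ∈ P × r ≡ lift (guard p)) ⊎ r ∈ H →
              ∃[ r′ ] r′ ∈ R × ruleTerms r ⊆ ruleTerms r′
      cover (inj₁ (p , p∈ , refl)) = _ , lift∈R p∈ , guard-terms p
      cover (inj₂ r∈H) with H⁻ r∈H
      ... | split {p} p∈ h∈ bs⊆ = _ , lift∈R p∈ , split-terms {p} h∈ bs⊆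
      ... | given d∈            = _ , fact∈R d∈ , id

    -- Instances of original, guarded and split rules.

    map-ρ̂-mapArgs : (f : T → T′) (as : List (Atom Symbol T)) →
                    map (mapArgs f) (map ρ̂ as) ≡ map ρ̂ (map (mapArgs f) as)
    map-ρ̂-mapArgs f as = trans (sym (map-∘ as)) (map-∘ as)

    guarded : GroundRule → GroundRule
    guarded (hs ← bs) = hs ← map ρ̂ (toList hs) ++ bs

    guard⁺ : ∀ {C} p {g} → Instance C (lift p) g → Instance C (lift (guard p)) (guarded g)
    guard⁺ p@(hs ← bs) {g} (σ , gr , e) = σ , (λ x → gr x ∘ guard-terms p) ,
      cong₂ _←_ (cong heads e) (trans (map-++ _ (map (mapPred (derived ∘ ρ)) (toList hs)) bs)
        (trans (cong₂ _++_ hs-eq (cong body e))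
          (sym (map-++ _ (map ρ̂ (toList (heads g))) (body g)))))
      where
      hs-eq : map (mapArgs (apply σ)) (map (mapPred (derived ∘ ρ)) (toList hs)) ≡
              map (mapArgs con) (map ρ̂ (toList (heads g)))
      -- A guard is `ρ̂` of a head regarded as a derived atom, and `ρ̂` commutes with substitution.
      hs-eq = trans (cong (map (mapArgs (apply σ))) (map-∘ (toList hs)))
        (trans (map-ρ̂-mapArgs (apply σ) (map (mapPred derived) (toList hs)))
          (trans (cong (map ρ̂ ∘ toList ∘ heads) e) (sym (map-ρ̂-mapArgs con (toList (heads g))))))

    guard⁻ : ∀ {C} p {g} → Instance C (lift (guard p)) g →
             ∃[ bs ] bs ⊆ body g × Instance C (lift p) (heads g ← bs)
    guard⁻ p@(hs ← bs) {g} (σ , gr , e)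
      with bs′ , sub , eq ← map≡++⁻ (mapArgs con) (body g) (map (mapArgs (apply σ)) _)
             (trans (sym (cong body e)) (map-++ _ (map (mapPred (derived ∘ ρ)) (toList hs)) bs)) =
      bs′ , sub , σ , (λ x → gr x ∘ terms-guard p) , cong₂ _←_ (cong heads e) (sym eq)

    -- The ground head `h` is the image of some head `h₀` of `p`; the renamed rule `h₀ ← B` is
    -- instantiated by the same `σ`.
    split⁺ : ∀ {C} p {g h} → Instance C (lift p) g → h ∈ toList (heads g) →
             ∃[ h₀ ] h₀ ∈ toList (heads p) ×
             Instance C (lift (rename (List⁺.[ h₀ ] ← body p))) (List⁺.[ ρ̂ h ] ← map ρ̂ (body g))
    split⁺ p {g} {h} (σ , gr , e) h∈
      with h₁ , h₁∈ , e₁ ← preimage (cong (toList ∘ heads) e) h∈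
      with h₀ , h₀∈ , refl ← ∈-map⁻ (mapPred derived) h₁∈ =
      h₀ , h₀∈ , σ , (λ x → gr x ∘ split-terms {p} h₀∈ (body⊆ p)) ,
      cong₂ _←_ (cong (List⁺.[_] ∘ ρ̂) (sym e₁))
        (trans (map-ρ̂-mapArgs (apply σ) (body p))
          (trans (cong (map ρ̂ ∘ body) e) (sym (map-ρ̂-mapArgs con (body g)))))

    -- The least model of `H`.

    HornClosed : Pred (Pred GroundAtom 0ℓ) 0ℓ
    HornClosed Z = ∀ {r g} → r ∈ H → Instance C r g →
                   All Z (body g) → All Z (toList (heads g))

    abstract
      leastHornClosed : ∃[ F ] HornClosed (_∈ F) × (∀ Z → HornClosed Z → All Z F)
      leastHornClosed with F , closed , least ← leastClosed (concatMap (instances C) H) =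
        F ,
        (λ {r} r∈ ins → closed (∈-concatMap (instances C) r∈ (instances⁺ {r = r} ins))) ,
        λ Z ZH → least Z λ g∈ →
          let r , r∈ , g∈r = ∈-concatMap-inv (instances C) H g∈
          in ZH r∈ (instances⁻ {r = r} g∈r)

    F : List GroundAtom
    F = proj₁ leastHornClosed

    F-closed : HornClosed (_∈ F)
    F-closed = proj₁ (proj₂ leastHornClosed)

    F-least : ∀ Z → HornClosed Z → All Z F
    F-least = proj₂ (proj₂ leastHornClosed)

    -- Old atoms, bounded atoms and freshness.

    -- `ρ̂` fixes base atoms, so a base atom is bounded exactly when it lies in `F`.
    Old Bounded : Pred GroundAtom 0ℓ
    Old a     = symbol a ∈ symbols R
    Bounded a = ρ̂ a ∈ F

    F-herbrand : All (Herbrand R′) F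
    F-herbrand = F-least (Herbrand R′) λ {r} {g} r∈ ins _ → All.tabulate λ a∈ →
      ground-herbrand {r = r} {g = g} (H⊆R′ r∈) ins (∈-++⁺ˡ a∈)

    lift-symbols : ∀ {p a} → p ∈ P → a ∈ ruleAtoms (lift p) → symbol a ∈ symbols (rules P)
    lift-symbols p∈ a∈ = ∈-symbols (∈-map⁺ lift p∈) a∈

    Old-derived : ∀ {k p} → (k , derived p) ∈ symbols R → (k , derived p) ∈ symbols (rules P)
    Old-derived p∈ with r , r∈ , a , a∈ , e ← symbols⁻ R p∈ with R⁻ r∈
    ... | inj₁ (p , p∈P , refl) = subst (_∈ symbols (rules P)) (sym e) (lift-symbols p∈P a∈)
    ... | inj₂ (d , d∈ , refl) with here refl ← a∈ with () ← e

    -- If `b` were derived, `a` would carry a renamed symbol, which freshness keeps out of `P` and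
    -- which no fact of `D` can have. So `b` is base and `ρ̂` fixes `a`.
    Old-renamed : ∀ {a : GroundAtom} {b : Atom Symbol Term} → symbol b ∈ symbols (rules P) →
                  symbol a ≡ symbol (ρ̂ b) → Old a → ρ̂ a ≡ a
    Old-renamed {b = atom (base _)    _} b∈ refl old = refl
    Old-renamed {b = atom (derived q) _} b∈ refl old = contradiction (Old-derived old) (new q b∈)

    Given : Pred GroundAtom 0ℓ
    Given a = ∃[ d ] d ∈ D × a ≡ baseAtom d

    -- Leastness serves as induction on `F`: facts are given outright, while the head of a split
    -- rule has a renamed symbol and is not `Old`.
    F-Old : ∀ {a} → a ∈ F → Old a → Given a
    F-Old a∈ = All.lookup (F-least (λ a → Old a → Given a) (λ r∈ ins _ → go (H⁻ r∈) ins)) a∈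
      where
      go : ∀ {r g} → Source r → Instance C r g → All (λ a → Old a → Given a) (toList (heads g))
      go (given {d} d∈) ins with refl ← fact⁻ {d = d} ins = (λ _ → d , d∈ , refl) ∷ []
      go (split {p} {h} p∈ h∈ _) (σ , _ , e) = All.tabulate λ a∈ old →
        let b , b∈ , e′ = preimage {f = mapArgs (apply σ)} (cong (toList ∘ heads) e) a∈
        in ⊥-elim (new (pred h) (lift-symbols {p} p∈ (head∈ p h∈))
             (Old-derived (subst (_∈ symbols R) (trans (cong symbol e′) (single b∈)) old)))
        where
        single : ∀ {b} → b ∈ mapPred derived (mapPred ρ h) ∷ [] →
                 symbol b ≡ (arity h , derived (ρ (pred h)))
        single (here refl) = refl

    given∈F : ∀ {d} → d ∈ D → baseAtom d ∈ F
    given∈F d∈ with p ∷ [] ← F-closed (fact∈H d∈) fact⁺ [] = p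

    given∈model : ∀ {M d} → Model R M → d ∈ D → baseAtom d ∈ M
    given∈model {d = d} (_ , rule) d∈
      with here p ← rule (factRule d) (fact d , fact∈R d∈ , fact⁺) [] = p

    F-Old∈model : ∀ {M a} → Model R M → a ∈ F → Old a → a ∈ M
    F-Old∈model model a∈ old with d , d∈ , refl ← F-Old a∈ old = given∈model model d∈

    -- Old atoms of `F` are facts of `D`, and every model of `R` contains these.
    ++F-Old : ∀ {M a} → Model R M → a ∈ M ++ F → Old a → a ∈ M
    ++F-Old {M} model a∈ old = [ id , (λ a∈F → F-Old∈model model a∈F old) ]′ (∈-++⁻ M a∈)

    -- Each head has its own renamed rule `a_i ← B`, whose body lies in `F` by assumption; the head
    -- of a fact lies in `F` already.
    Bounded-heads : ∀ {g} → ground R g → All Bounded (body g) → All Bounded (toList (heads g))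
    Bounded-heads {g} (r , r∈ , ins) bounded with R⁻ r∈
    ... | inj₁ (p , p∈ , refl) = All.tabulate λ h∈ →
      let h₀ , h₀∈ , ins′ = split⁺ p {g} (Instance-weaken terms-R⊆R′ ins) h∈
      in All.head (F-closed (split∈H p∈ h₀∈) ins′ (All.map⁺ bounded))
    ... | inj₂ (d , d∈ , refl) with refl ← fact⁻ {d = d} ins = given∈F d∈ ∷ []

    model-Old : ∀ {M a} → Interpretation R M → a ∈ M → Old a
    model-Old int a∈ = proj₁ (All.lookup int a∈)

    ground-Old : ∀ {g a} → ground R g → a ∈ ruleAtoms g → Old a
    ground-Old {g} (r , r∈ , ins) a∈ = proj₁ (ground-herbrand {r = r} {g} r∈ ins a∈)

    -- The single-head rules of `H` belong to `R′`, so a model of `R′` is closed under them and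
    -- leastness applies.
    lower : ∀ {N} → Model R′ N → F ⊆ N
    lower {N} (_ , rule) a∈ = All.lookup (F-least (_∈ N) closed) a∈
      where
      go : ∀ {r g} → Source r → Instance C r g → Any (_∈ N) (toList (heads g)) →
           All (_∈ N) (toList (heads g))
      go {g = g} (split _ _ _) (_ , _ , e) = singleHead (heads g) (cong heads e)
      go {g = g} (given _)     (_ , _ , e) = singleHead (heads g) (cong heads e)

      closed : HornClosed (_∈ N)
      closed {r} {g} r∈ ins b⊆ = go (H⁻ r∈) ins (rule g (r , H⊆R′ r∈ , ins) b⊆)

    -- From models of `R` to models of `R′`.

    symbols-R⊆R′ : symbols R ⊆ symbols R′
    symbols-R⊆R′ s∈ with r , r∈ , a , a∈ , refl ← symbols⁻ R s∈ with R⁻ r∈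
    ... | inj₂ (d , d∈ , refl) = ∈-symbols (H⊆R′ (fact∈H d∈)) a∈
    ... | inj₁ (p , p∈ , refl) = ∈-symbols (guard∈R′ p∈) (lift⊆guard p a∈)

    -- Rules of `H` hold because `F` is closed under them, guarded rules because `M` satisfies the
    -- originals.
    extend : ∀ {M} → Model R M → All Bounded M → Model R′ (M ++ F)
    extend {M} model@(int , rule) bounded =
      All.++⁺ (All.map (λ (s∈ , c∈) → symbols-R⊆R′ s∈ , λ c → terms-R⊆R′ ∘ c∈ c) int) F-herbrand ,
      rule′
      where
      horn-body : ∀ {r g a} → Source r → Instance C r g → a ∈ body g → a ∈ M ++ F → a ∈ F
      horn-body (given {d} _) ins a∈ with refl ← fact⁻ {d = d} ins with () ← a∈
      horn-body (split {p} p∈ h∈ bs⊆) (σ , _ , e) a∈ a∈MF with ∈-++⁻ M a∈MF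
      ... | inj₂ a∈F = a∈F
      -- This body atom has the symbol of a renamed atom, yet is old since it lies in `M`; so `ρ̂`
      -- fixes it and boundedness puts it in `F`.
      ... | inj₁ a∈M
        with b , b∈ , e′ ← preimage {f = mapArgs (apply σ)} (cong body e) a∈
        with b₀ , b₀∈ , refl ← ∈-map⁻ ρ̂ b∈ =
        subst (_∈ F) (Old-renamed {b = b₀} (lift-symbols {p} p∈ (bs⊆ b₀∈)) (cong symbol e′)
          (model-Old int a∈M)) (All.lookup bounded a∈M)

      rule′ : ∀ g → ground R′ g → All (_∈ M ++ F) (body g) → Any (_∈ M ++ F) (toList (heads g))
      rule′ g (r , r∈ , ins) b⊆ with R′⁻ r∈
      ... | inj₂ r∈H = here (∈-++⁺ʳ M (All.head (F-closed r∈H ins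
        (All.tabulate λ a∈ → horn-body (H⁻ r∈H) ins a∈ (All.lookup b⊆ a∈)))))
      -- The atoms of the original body are old, so they lie in `M` itself and the original rule
      -- applies there.
      ... | inj₁ (p , p∈ , refl) with bs , bs⊆ , ins′ ← guard⁻ p {g} ins =
        Any.map ∈-++⁺ˡ (rule (heads g ← bs) gr (All.tabulate λ a∈ →
          ++F-Old model (All.lookup b⊆ (bs⊆ a∈))
            (ground-Old gr (∈-++⁺ʳ (toList (heads g)) a∈))))
        where
        gr : ground R (heads g ← bs)
        gr = lift p , lift∈R p∈ , Instance-weaken {r = lift p} {heads g ← bs} terms-R′⊆R ins′

    -- From models of `R′` to models of `R`.

    restrictable? : ∀ a → Dec (Old a × Bounded a)
    restrictable? a = (symbol a ∈ˢ? symbols R) ×-dec (ρ̂ a ∈? F)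

    restrict : List GroundAtom → List GroundAtom
    restrict = filter restrictable?

    restrict⁺ : ∀ {N a} → a ∈ N → Old a → Bounded a → a ∈ restrict N
    restrict⁺ a∈ old bounded = ∈-filter⁺ restrictable? a∈ (old , bounded)

    restrict⁻ : ∀ N {a} → a ∈ restrict N → a ∈ N × Old a × Bounded a
    restrict⁻ N = ∈-filter⁻ restrictable? {xs = N}

    -- A body in `restrict N` is bounded, hence so are the heads. Their renamings lie in `F`, thus
    -- in `N`, so the guarded rule fires in `N`; the head it yields is old and bounded.
    restrict-model : ∀ {N} → Model R′ N → Model R (restrict N)
    restrict-model {N} model@(int , rule) = All.tabulate herbrand , rule′
      where
      herbrand : ∀ {a} → a ∈ restrict N → Herbrand R a
      herbrand a∈ with a∈N , old , _ ← restrict⁻ N a∈ =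
        old , λ c → terms-R′⊆R ∘ proj₂ (All.lookup int a∈N) c

      rule′ : ∀ g → ground R g → All (_∈ restrict N) (body g) →
              Any (_∈ restrict N) (toList (heads g))
      rule′ g gr@(r , r∈ , ins) b⊆ = conclude
        where
        bounded : All Bounded (toList (heads g))
        bounded = Bounded-heads gr (All.map (proj₂ ∘ proj₂ ∘ restrict⁻ N) b⊆)

        some : Any (_∈ N) (toList (heads g))
        some with R⁻ r∈
        ... | inj₁ (p , p∈ , refl) = rule (guarded g)
          (lift (guard p) , guard∈R′ p∈ , guard⁺ p {g} (Instance-weaken terms-R⊆R′ ins))
          (All.++⁺ (All.map⁺ (All.map (lower model) bounded))
                   (All.map (proj₁ ∘ restrict⁻ N) b⊆))
        ... | inj₂ (d , d∈ , refl) with refl ← fact⁻ {d = d} ins = here (lower model (given∈F d∈))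

        conclude : Any (_∈ restrict N) (toList (heads g))
        conclude with h , h∈ , h∈N ← find some =
          lose h∈ (restrict⁺ h∈N (ground-Old gr (∈-++⁺ˡ h∈)) (All.lookup bounded h∈))

    -- Correspondence of the stable models.

    stable-Bounded : ∀ {M} → StableModel R M → All Bounded M
    stable-Bounded {M} ((int , rule) , minimal) =
      All.tabulate (proj₂ ∘ filtered⁻ ∘ minimal M′ model′ (proj₁ ∘ filtered⁻))
      where
      Bounded? : ∀ a → Dec (Bounded a)
      Bounded? a = ρ̂ a ∈? F

      M′ : List GroundAtom
      M′ = filter Bounded? M

      filtered⁻ : ∀ {a} → a ∈ M′ → a ∈ M × Bounded a
      filtered⁻ = ∈-filter⁻ Bounded? {xs = M}

      rule′ : ∀ g → ground R g → All (_∈ M′) (body g) → Any (_∈ M′) (toList (heads g))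
      rule′ g gr b⊆
        with h , h∈ , h∈M ← find (rule g gr (All.map (proj₁ ∘ filtered⁻) b⊆)) =
        lose h∈ (∈-filter⁺ Bounded? h∈M
          (All.lookup (Bounded-heads gr (All.map (proj₂ ∘ filtered⁻) b⊆)) h∈))

      model′ : Model R M′
      model′ = All.filter⁺ Bounded? int , rule′

    extend-stable : ∀ {M} → StableModel R M → StableModel R′ (M ++ F)
    extend-stable {M} stable@(model@(int , _) , minimal) =
      extend model (stable-Bounded stable) , minimal′
      where
      minimal′ : ∀ N → Model R′ N → N ⊆ M ++ F → M ++ F ⊆ N
      minimal′ N model′ N⊆ = [ proj₁ ∘ restrict⁻ N ∘ M⊆ , lower model′ ]′ ∘ ∈-++⁻ M
        where
        -- The old atoms of `N` lie in `M`, so `restrict N` is a model inside `M` and minimality of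
        -- `M` applies.
        M⊆ : M ⊆ restrict N
        M⊆ = minimal (restrict N) (restrict-model model′) λ a∈ →
          let a∈N , old , _ = restrict⁻ N a∈ in ++F-Old model (N⊆ a∈N) old

    -- `M ++ F` is a model of `R′` inside `N`, so minimality of `N` applies. It is used both for
    -- `M = restrict N` and for an arbitrary model `M` below it.
    ⊆-extension : ∀ {N M} → StableModel R′ N → Model R M → M ⊆ restrict N → N ⊆ M ++ F
    ⊆-extension {N} {M} (model , minimal) modelM M⊆ =
      minimal (M ++ F) (extend modelM (All.tabulate (proj₂ ∘ proj₂ ∘ restrict⁻ N ∘ M⊆)))
        ([ proj₁ ∘ restrict⁻ N ∘ M⊆ , lower model ]′ ∘ ∈-++⁻ M)

    -- A stable `N` lies in `restrict N ++ F`, whose old atoms are all in `restrict N`; so the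
    -- boundedness test removes no old atom.
    restrict-Old : ∀ {N a} → StableModel R′ N → a ∈ N → Old a → a ∈ restrict N
    restrict-Old stable@(model , _) a∈ =
      ++F-Old (restrict-model model) (⊆-extension stable (restrict-model model) id a∈)

    -- A model `M` inside `restrict N` gives `N ⊆ M ++ F`; on old atoms this reads `restrict N ⊆ M`.
    restrict-stable : ∀ {N} → StableModel R′ N → StableModel R (restrict N)
    restrict-stable {N} stable@(model , _) = restrict-model model , λ M modelM M⊆ a∈ →
      let a∈N , old , _ = restrict⁻ N a∈
      in ++F-Old modelM (⊆-extension stable modelM M⊆ a∈N) old

    -- Answers to the goal.

    module _ (G : Atom Symbol Term) (G∈ : symbol G ∈ symbols (rules P)) where

      rules-Old : ∀ {s} → s ∈ symbols (rules P) → s ∈ symbols R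
      rules-Old s∈ with r , r∈ , a , a∈ , refl ← symbols⁻ (rules P) s∈ = ∈-symbols (∈-++⁺ˡ r∈) a∈

      -- A ground instance of `G` has the symbol of `G`, which occurs in `P`; so comparing old atoms
      -- is enough.
      A-mono : ∀ {M N θ} → (∀ {a} → Old a → a ∈ M → a ∈ N) → A G M θ → A G N θ
      A-mono sub (a , a∈ , e) =
        a , sub (subst (_∈ symbols R) (cong symbol e) (rules-Old G∈)) a∈ , e

      equivalent : (possible ⟪ G , P ⟫ D ≐ possible ⟪ G , Rew ρ P ⟫ D) ×
                   (certain ⟪ G , P ⟫ D ≐ certain ⟪ G , Rew ρ P ⟫ D)
      equivalent =
        ( (λ (M , stable , a) → M ++ F , extend-stable stable , A-mono (λ _ → ∈-++⁺ˡ) a)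
        , (λ (N , stable , a) → restrict N , restrict-stable stable ,
             A-mono (λ old a∈ → restrict-Old stable a∈ old) a) ) ,
        -- Certain answers move against the correspondence: the answer at `N` is read off from
        -- `restrict N`, and the one at `M` from `M ++ F`.
        ( (λ cert N stable →
             A-mono (λ _ → proj₁ ∘ restrict⁻ N) (cert (restrict N) (restrict-stable stable)))
        , (λ cert M stable →
             A-mono (λ old a∈ → ++F-Old (proj₁ stable) a∈ old) (cert (M ++ F) (extend-stable stable))) )

proposition1 : (S : Signature) → let open Datalog S in
    (P : Program) (ρ : Renaming) → Fresh P ρ →
    (G : Atom Symbol Term) → symbol G ∈ symbols (rules P) →
    ⟪ G , P ⟫ ≋ ⟪ G , Rew ρ P ⟫
proposition1 S P ρ fresh G G∈ D = equivalent S P ρ fresh D G G∈
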